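{- Let $(r_k)_{k\ge 1}$, $(s_k)_{k\ge 0}$, $(t_k)_{k\ge 1}$ be sequences of nonnegative real numbers, and let $A=[a_{n,k}]_{n,k\ge 0}$ be the infinite lower triangular matrix with $a_{n,k}=0$ unless $n\ge k\ge 0$, defined by $$a_{0,0}=1,\quad a_{n+1,0}=s_0a_{n,0}+t_1a_{n,1},\quad a_{n+1,k}=r_{k}a_{n,k-1}+s_ka_{n,k}+t_{k+1}a_{n,k+1}\quad (k\ge 1,\ n\ge 0).$$ If $s_0\ge 1$ and $s_k\ge r_kt_k+1$ for all $k\ge 1$, then $A$ is TP.
   Context: A real (finite or infinite) matrix is TP (totally positive) if its minors of all orders are nonnegative. -}

module Defs where

open import Algebra.Bundles using (CommutativeRing)
import Algebra.Properties.Semiring.Exp as Exp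
import Algebra.Properties.Semiring.Sum as Sum
open import Data.Fin as Fin using (Fin; toℕ)
open import Data.Nat as ℕ using (ℕ; zero; suc; _⊔_)
import Data.Nat.Properties as ℕ
open import Data.Product using (∃; ∃-syntax; _×_; _,_; proj₁; proj₂)
open import Data.Rational as ℚ using (ℚ; 0ℚ; 1ℚ; ½; ∣_∣)
import Data.Rational.Properties as ℚ
open import Data.Rational.Solver using (module +-*-Solver)
open import Data.Vec.Functional using (removeAt)
open import Level using (0ℓ)
open import Relation.Binary.Core using (_Preserves_⟶_)
open import Relation.Binary.PropositionalEquality
  using (_≡_; refl; sym; trans; cong; subst)

module Determinant {c ℓ} (R : CommutativeRing c ℓ) where
  open CommutativeRing R
  open Exp semiring using (_^_)
  open Sum semiring using (sum)

  -- Laplace expansion along row zero.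
  det : ∀ {n} → (Fin n → Fin n → Carrier) → Carrier
  det {zero}  M = 1#
  det {suc n} M =
    sum λ j → (- 1#) ^ toℕ j * (M Fin.zero j * det (λ i → removeAt (M (Fin.suc i)) j))

open import Data.Rational using (_+_; _*_; _-_; -_; _<_)
open import Data.Rational.Properties using (module ≤-Reasoning)
open ≤-Reasoning
open +-*-Solver

abstract
  0<1 : 0ℚ < 1ℚ
  0<1 = ℚ.positive⁻¹ 1ℚ

  ∣p-p∣<ε : ∀ p {ε} → 0ℚ < ε → ∣ p - p ∣ < ε
  ∣p-p∣<ε p = subst (_< _) (sym (cong ∣_∣ (ℚ.+-inverseʳ p)))

  ∣p-q∣≡∣q-p∣ : ∀ p q → ∣ p - q ∣ ≡ ∣ q - p ∣
  ∣p-q∣≡∣q-p∣ p q = trans (sym (ℚ.∣-p∣≡∣p∣ (p - q)))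
    (cong ∣_∣ (solve 2 (λ x y → :- (x :- y) := y :- x) refl p q))

  +-close : ∀ a b c d {δ η} → ∣ a - c ∣ < δ → ∣ b - d ∣ < η →
            ∣ (a + b) - (c + d) ∣ < δ + η
  +-close a b c d {δ} {η} p q = begin-strict
    ∣ (a + b) - (c + d) ∣    ≡⟨ cong ∣_∣ (solve 4 (λ a b c d →
                                  (a :+ b) :- (c :+ d) := (a :- c) :+ (b :- d))
                                  refl a b c d) ⟩
    ∣ (a - c) + (b - d) ∣    ≤⟨ ℚ.∣p+q∣≤∣p∣+∣q∣ (a - c) (b - d) ⟩
    ∣ a - c ∣ + ∣ b - d ∣    <⟨ ℚ.+-mono-< p q ⟩
    δ + η                    ∎

  close-trans : ∀ a b c {δ η} → ∣ a - b ∣ < δ → ∣ b - c ∣ < η → ∣ a - c ∣ < δ + η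
  close-trans a b c p q = subst (_< _)
    (cong ∣_∣ (solve 3 (λ a b c → (a :+ b) :- (b :+ c) := a :- c) refl a b c))
    (+-close a b b c p q)

  close-bound : ∀ a b {δ} → ∣ a - b ∣ < δ → ∣ a ∣ < δ + ∣ b ∣
  close-bound a b {δ} p = begin-strict
    ∣ a ∣                ≡⟨ cong ∣_∣ (solve 2 (λ a b → a := (a :- b) :+ b) refl a b) ⟩
    ∣ (a - b) + b ∣      ≤⟨ ℚ.∣p+q∣≤∣p∣+∣q∣ (a - b) b ⟩
    ∣ a - b ∣ + ∣ b ∣    <⟨ ℚ.+-monoˡ-< ∣ b ∣ p ⟩
    δ + ∣ b ∣            ∎

  neg-close : ∀ a b {δ} → ∣ a - b ∣ < δ → ∣ (- a) - (- b) ∣ < δ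
  neg-close a b = subst (_< _) (trans (sym (ℚ.∣-p∣≡∣p∣ (a - b)))
    (cong ∣_∣ (solve 2 (λ a b → :- (a :- b) := (:- a) :- (:- b)) refl a b)))

  ∣*∣< : ∀ M p q {δ} → 0ℚ < M → ∣ p ∣ < M → ∣ q ∣ < δ → ∣ p * q ∣ < M * δ
  ∣*∣< M p q {δ} 0<M p<M q<δ = begin-strict
    ∣ p * q ∣      ≡⟨ ℚ.∣p*q∣≡∣p∣*∣q∣ p q ⟩
    ∣ p ∣ * ∣ q ∣  ≤⟨ ℚ.*-monoʳ-≤-nonNeg ∣ q ∣ ⦃ ℚ.nonNegative (ℚ.0≤∣p∣ q) ⦄ (ℚ.<⇒≤ p<M) ⟩
    M * ∣ q ∣      <⟨ ℚ.*-monoʳ-<-pos M ⦃ ℚ.positive 0<M ⦄ q<δ ⟩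
    M * δ          ∎

  *-close : ∀ M a b c d {δ} → 0ℚ < M → ∣ a ∣ < M → ∣ d ∣ < M →
            ∣ a - c ∣ < δ → ∣ b - d ∣ < δ → ∣ a * b - c * d ∣ < M * δ + M * δ
  *-close M a b c d {δ} 0<M a<M d<M p q = begin-strict
    ∣ a * b - c * d ∣                    ≡⟨ cong ∣_∣ (solve 4 (λ a b c d →
                                              (a :* b) :- (c :* d) :=
                                              a :* (b :- d) :+ d :* (a :- c))
                                              refl a b c d) ⟩
    ∣ a * (b - d) + d * (a - c) ∣        ≤⟨ ℚ.∣p+q∣≤∣p∣+∣q∣ (a * (b - d)) (d * (a - c)) ⟩
    ∣ a * (b - d) ∣ + ∣ d * (a - c) ∣    <⟨ ℚ.+-mono-< (∣*∣< M a (b - d) 0<M a<M q)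
                                                      (∣*∣< M d (a - c) 0<M d<M p) ⟩
    M * δ + M * δ                        ∎

  halve : ∀ ε → 0ℚ < ε → ∃[ δ ] (0ℚ < δ × δ + δ ≡ ε)
  halve ε 0<ε = ½ * ε
    , subst (_< ½ * ε) (ℚ.*-zeroʳ ½) (ℚ.*-monoʳ-<-pos ½ 0<ε)
    , trans (sym (ℚ.*-distribʳ-+ ε ½ ½)) (ℚ.*-identityˡ ε)

  halve/ : ∀ M ε → 0ℚ < M → 0ℚ < ε → ∃[ δ ] (0ℚ < δ × M * δ + M * δ ≡ ε)
  halve/ M ε 0<M 0<ε = M⁻¹ * η
    , subst (_< M⁻¹ * η) (ℚ.*-zeroʳ M⁻¹)
        (ℚ.*-monoʳ-<-pos M⁻¹ ⦃ ℚ.1/pos⇒pos M ⦃ M-pos ⦄ ⦄ (proj₁ (proj₂ (halve ε 0<ε))))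
    , trans (cong (λ x → x + x) Mδ≡η) (proj₂ (proj₂ (halve ε 0<ε)))
    where
    M-pos : ℚ.Positive M
    M-pos = ℚ.positive 0<M
    M-nonZero : ℚ.NonZero M
    M-nonZero = ℚ.pos⇒nonZero M ⦃ M-pos ⦄
    η M⁻¹ : ℚ
    η   = proj₁ (halve ε 0<ε)
    M⁻¹ = (ℚ.1/ M) ⦃ M-nonZero ⦄
    Mδ≡η : M * (M⁻¹ * η) ≡ η
    Mδ≡η = trans (sym (ℚ.*-assoc M M⁻¹ η))
      (trans (cong (_* η) (ℚ.*-inverseʳ M ⦃ M-nonZero ⦄)) (ℚ.*-identityˡ η))

Eventually : (ℕ → Set) → Set
Eventually P = ∃[ N ] (∀ n → N ℕ.≤ n → P n)

⊔≤ˡ : ∀ m n k → m ⊔ n ℕ.≤ k → m ℕ.≤ k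
⊔≤ˡ m n k = ℕ.m⊔n≤o⇒m≤o m n

⊔≤ʳ : ∀ m n k → m ⊔ n ℕ.≤ k → n ℕ.≤ k
⊔≤ʳ m n k = ℕ.m⊔n≤o⇒n≤o m n

both : ∀ {P Q R : ℕ → Set} → (∀ n → P n → Q n → R n) →
       Eventually P → Eventually Q → Eventually R
both f (M , p) (N , q) = M ⊔ N , λ n h →
  f n (p n (⊔≤ˡ M N n h)) (q n (⊔≤ʳ M N n h))

-- Equality of reals is _≃_ below, not _≡_.
record ℝ : Set where
  no-eta-equality
  field
    seq    : ℕ → ℚ
    cauchy : ∀ ε → 0ℚ ℚ.< ε →
             ∃[ N ] (∀ m n → N ℕ.≤ m → N ℕ.≤ n → ∣ seq m ℚ.- seq n ∣ ℚ.< ε)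

open ℝ public

infix 4 _≃_ _≤_

record _≃_ (x y : ℝ) : Set where
  constructor mk≃
  field
    close : ∀ ε → 0ℚ ℚ.< ε → Eventually λ n → ∣ seq x n ℚ.- seq y n ∣ ℚ.< ε

-- The slack ε is needed because a limit may be approached from above.
record _≤_ (x y : ℝ) : Set where
  constructor mk≤
  field
    below : ∀ ε → 0ℚ ℚ.< ε → Eventually λ n → seq x n ℚ.≤ seq y n ℚ.+ ε

open _≃_ public
open _≤_ public

fromℚ : ℚ → ℝ
seq    (fromℚ q) _ = q
cauchy (fromℚ q) ε 0<ε = 0 , λ _ _ _ _ → ∣p-p∣<ε q 0<ε

0ℝ 1ℝ : ℝ
0ℝ = fromℚ 0ℚ
1ℝ = fromℚ 1ℚ

bounded : ∀ x → ∃[ B ] (0ℚ ℚ.< B × Eventually λ n → ∣ seq x n ∣ ℚ.< B)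
bounded x = 1ℚ + ∣ seq x N ∣
  , ℚ.≤-<-trans (ℚ.0≤∣p∣ (seq x N)) (bound N ℕ.≤-refl)
  , N , bound
  where
  N = proj₁ (cauchy x 1ℚ 0<1)
  bound : ∀ n → N ℕ.≤ n → ∣ seq x n ∣ < 1ℚ + ∣ seq x N ∣
  bound n N≤n = close-bound (seq x n) (seq x N) (proj₂ (cauchy x 1ℚ 0<1) n N N≤n ℕ.≤-refl)

bounded₂ : ∀ x y → ∃[ B ] (0ℚ ℚ.< B ×
           Eventually λ n → ∣ seq x n ∣ ℚ.< B × ∣ seq y n ∣ ℚ.< B)
bounded₂ x y with bounded x | bounded y
... | B , 0<B , p | C , 0<C , q = B + C
  , ℚ.<-trans 0<B B<B+C
  , both (λ n b c → ℚ.<-trans b B<B+C , ℚ.<-trans c C<B+C) p q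
  where
  B<B+C : B < B + C
  B<B+C = subst (_< B + C) (ℚ.+-identityʳ B) (ℚ.+-monoʳ-< B 0<C)
  C<B+C : C < B + C
  C<B+C = subst (_< B + C) (ℚ.+-identityˡ C) (ℚ.+-monoˡ-< C 0<B)

infixl 6 _⊕_
infixl 7 _⊗_
infix  8 ⊖_

_⊕_ : ℝ → ℝ → ℝ
seq    (x ⊕ y) n = seq x n ℚ.+ seq y n
cauchy (x ⊕ y) ε 0<ε =
  let δ , 0<δ , δ+δ≡ε = halve ε 0<ε
      M , p = cauchy x δ 0<δ
      N , q = cauchy y δ 0<δ
      M≤ = ⊔≤ˡ M N
      N≤ = ⊔≤ʳ M N
  in M ⊔ N , λ m n hm hn → subst (_ <_) δ+δ≡ε
       (+-close (seq x m) (seq y m) (seq x n) (seq y n)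
         (p m n (M≤ m hm) (M≤ n hn)) (q m n (N≤ m hm) (N≤ n hn)))

_⊗_ : ℝ → ℝ → ℝ
seq    (x ⊗ y) n = seq x n ℚ.* seq y n
cauchy (x ⊗ y) ε 0<ε =
  let B , 0<B , L , b = bounded₂ x y
      δ , 0<δ , eq = halve/ B ε 0<B 0<ε
      M , p = cauchy x δ 0<δ
      N , q = cauchy y δ 0<δ
      L≤ = λ k h → ⊔≤ˡ L M k (⊔≤ˡ (L ⊔ M) N k h)
      M≤ = λ k h → ⊔≤ʳ L M k (⊔≤ˡ (L ⊔ M) N k h)
      N≤ = ⊔≤ʳ (L ⊔ M) N
  in L ⊔ M ⊔ N , λ m n hm hn → subst (_ <_) eq
       (*-close B (seq x m) (seq y m) (seq x n) (seq y n) 0<B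
         (proj₁ (b m (L≤ m hm))) (proj₂ (b n (L≤ n hn)))
         (p m n (M≤ m hm) (M≤ n hn)) (q m n (N≤ m hm) (N≤ n hn)))

⊖_ : ℝ → ℝ
seq    (⊖ x) n = ℚ.- seq x n
cauchy (⊖ x) ε 0<ε =
  let N , p = cauchy x ε 0<ε
  in N , λ m n hm hn → neg-close (seq x m) (seq x n) (p m n hm hn)

pointwise : ∀ {x y} → (∀ n → seq x n ≡ seq y n) → x ≃ y
pointwise {x} eq .close ε 0<ε = 0 , λ n _ →
  subst (λ q → ∣ seq x n - q ∣ < ε) (eq n) (∣p-p∣<ε (seq x n) 0<ε)

≃-refl : ∀ {x} → x ≃ x
≃-refl = pointwise λ _ → refl

≃-sym : ∀ {x y} → x ≃ y → y ≃ x
≃-sym {x} {y} p .close ε 0<ε with close p ε 0<ε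
... | N , h = N , λ n N≤n → subst (_< ε) (∣p-q∣≡∣q-p∣ (seq x n) (seq y n)) (h n N≤n)

≃-trans : ∀ {x y z} → x ≃ y → y ≃ z → x ≃ z
≃-trans {x} {y} {z} p q .close ε 0<ε with halve ε 0<ε
... | δ , 0<δ , refl =
  both (λ n → close-trans (seq x n) (seq y n) (seq z n)) (close p δ 0<δ) (close q δ 0<δ)

⊕-cong : ∀ {x y u v} → x ≃ y → u ≃ v → x ⊕ u ≃ y ⊕ v
⊕-cong {x} {y} {u} {v} p q .close ε 0<ε with halve ε 0<ε
... | δ , 0<δ , refl =
  both (λ n → +-close (seq x n) (seq u n) (seq y n) (seq v n))
    (close p δ 0<δ) (close q δ 0<δ)

⊗-cong : ∀ {x y u v} → x ≃ y → u ≃ v → x ⊗ u ≃ y ⊗ v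
⊗-cong {x} {y} {u} {v} p q .close ε 0<ε with bounded₂ x v
... | B , 0<B , b with halve/ B ε 0<B 0<ε
... | δ , 0<δ , refl =
  both (λ n (bx , bv) (c , d) →
          *-close B (seq x n) (seq u n) (seq y n) (seq v n) 0<B bx bv c d)
    b (both (λ _ → _,_) (close p δ 0<δ) (close q δ 0<δ))

⊖-cong : ∀ {x y} → x ≃ y → ⊖ x ≃ ⊖ y
⊖-cong {x} {y} p .close ε 0<ε with close p ε 0<ε
... | N , h = N , λ n N≤n → neg-close (seq x n) (seq y n) (h n N≤n)

ℝ-commutativeRing : CommutativeRing 0ℓ 0ℓ
ℝ-commutativeRing = record
  { Carrier = ℝ
  ; _≈_ = _≃_
  ; _+_ = _⊕_
  ; _*_ = _⊗_
  ; -_  = ⊖_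
  ; 0#  = 0ℝ
  ; 1#  = 1ℝ
  ; isCommutativeRing = record
    { isRing = record
      { +-isAbelianGroup = record
        { isGroup = record
          { isMonoid = record
            { isSemigroup = record
              { isMagma = record
                { isEquivalence = record
                  { refl  = ≃-refl
                  ; sym   = ≃-sym
                  ; trans = ≃-trans
                  }
                ; ∙-cong = ⊕-cong
                }
              ; assoc = λ x y z → pointwise λ n → ℚ.+-assoc (seq x n) (seq y n) (seq z n)
              }
            ; identity = (λ x → pointwise λ n → ℚ.+-identityˡ (seq x n))
                       , (λ x → pointwise λ n → ℚ.+-identityʳ (seq x n))
            }
          ; inverse = (λ x → pointwise λ n → ℚ.+-inverseˡ (seq x n))
                    , (λ x → pointwise λ n → ℚ.+-inverseʳ (seq x n))
          ; ⁻¹-cong = ⊖-cong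
          }
        ; comm = λ x y → pointwise λ n → ℚ.+-comm (seq x n) (seq y n)
        }
      ; *-cong = ⊗-cong
      ; *-assoc = λ x y z → pointwise λ n → ℚ.*-assoc (seq x n) (seq y n) (seq z n)
      ; *-identity = (λ x → pointwise λ n → ℚ.*-identityˡ (seq x n))
                   , (λ x → pointwise λ n → ℚ.*-identityʳ (seq x n))
      ; distrib = (λ x y z → pointwise λ n → ℚ.*-distribˡ-+ (seq x n) (seq y n) (seq z n))
                , (λ x y z → pointwise λ n → ℚ.*-distribʳ-+ (seq x n) (seq y n) (seq z n))
      }
    ; *-comm = λ x y → pointwise λ n → ℚ.*-comm (seq x n) (seq y n)
    }
  }

open Determinant ℝ-commutativeRing public using (det)

InfiniteMatrix : Set
InfiniteMatrix = ℕ → ℕ → ℝ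

StrictlyIncreasing : ∀ {m} → (Fin m → ℕ) → Set
StrictlyIncreasing f = f Preserves Fin._<_ ⟶ ℕ._<_

minor : ∀ {m} → InfiniteMatrix → (rows cols : Fin m → ℕ) → ℝ
minor A rows cols = det λ i j → A (rows i) (cols j)

TotallyPositive : InfiniteMatrix → Set
TotallyPositive A = ∀ {m} (rows cols : Fin m → ℕ) →
  StrictlyIncreasing rows → StrictlyIncreasing cols → 0ℝ ≤ minor A rows cols

-- The values r 0 and t 0 are never used: r and t are indexed from one.
-- That entries above the diagonal vanish is not imposed beyond row zero, since
-- the recurrence implies it (recursiveMatrix-lowerTriangular).
recursiveMatrix : (r s t : ℕ → ℝ) → InfiniteMatrix
recursiveMatrix r s t = a
  where
  a : InfiniteMatrix
  a zero    zero    = 1ℝ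
  a zero    (suc k) = 0ℝ
  a (suc n) zero    = s 0 ⊗ a n 0 ⊕ t 1 ⊗ a n 1
  a (suc n) (suc k) =
    r (suc k) ⊗ a n k ⊕ s (suc k) ⊗ a n (suc k) ⊕ t (suc (suc k)) ⊗ a n (suc (suc k))

recursiveMatrix-lowerTriangular :
  ∀ r s t n k → n ℕ.< k → recursiveMatrix r s t n k ≃ 0ℝ
recursiveMatrix-lowerTriangular r s t zero    (suc k) _ = ≃-refl
recursiveMatrix-lowerTriangular r s t (suc n) (suc k) (ℕ.s≤s n<k) =
  R.trans (R.+-cong (R.+-cong (vanish (r (suc k)) n<k)
                              (vanish (s (suc k)) (ℕ.m<n⇒m<1+n n<k)))
                    (vanish (t (suc (suc k))) (ℕ.m<n⇒m<1+n (ℕ.m<n⇒m<1+n n<k))))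
          (R.trans (R.+-identityʳ (0ℝ ⊕ 0ℝ)) (R.+-identityʳ 0ℝ))
  where
  module R = CommutativeRing ℝ-commutativeRing
  vanish : ∀ x {j} → n ℕ.< j → x ⊗ recursiveMatrix r s t n j ≃ 0ℝ
  vanish x n<j = R.trans
    (R.*-congˡ (recursiveMatrix-lowerTriangular r s t n _ n<j)) (R.zeroʳ x)

{-# OPTIONS --safe #-}
module Submission where

-- Let A' be A without its row zero; the recurrence says A' = A J for the
-- tridiagonal matrix J with diagonal s, superdiagonal r and subdiagonal t.
-- Put d k = s k - (r k * t k + 1), and d 0 = s 0 - 1; these are nonnegative,
-- and J = L U + D, where L is lower bidiagonal with unit diagonal and
-- subdiagonal t, U is upper bidiagonal with unit diagonal and superdiagonal r,
-- and D is the diagonal matrix of the d k.  In terms of columns, with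
-- B k = A k + t (k + 1) * A (k + 1) the columns of A L,
--
--   A' k = r k * B (k - 1) + d k * A k + B k,
--
-- where the first term is absent for k = 0.
--
-- Everything rests on a windowing principle (colPositive-windows).  Suppose the
-- minors of V on strictly increasing columns are nonnegative, and column k of
-- W is a nonnegative combination of the columns of V with index in a window
-- [lo k , hi k], where hi k ≤ lo k' for k < k'.  Then the minors of W are
-- nonnegative: expanding a minor of W by multilinearity gives nonnegative
-- multiples of determinants of V on weakly increasing columns, and such a
-- determinant is a minor of V or has two equal adjacent columns.  This takes
-- the place of the Cauchy-Binet formula.
--
-- The principle applies twice: the columns of A are interleaved as
-- A 0, B 0, A 1, B 1, ..., where consecutive windows share at most an
-- endpoint, and then A' k is a combination of three consecutive columns of the
-- interleaved matrix, the windows for k and k + 1 sharing only the column B k.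
-- So if the minors of A on rows below N are nonnegative, those on nonzero rows
-- below N + 1 are too (minor-suc-nonNeg).  As row zero of A is (1, 0, 0, ...),
-- a minor using row zero reduces to one that does not, and induction on N
-- concludes.

open import Algebra.Bundles using (CommutativeRing)
import Algebra.Properties.Ring as RingProperties
import Algebra.Properties.Semiring.Exp as Exp
import Algebra.Properties.Semiring.Sum as Sum
import Algebra.Solver.Ring.NaturalCoefficients.Default as Solver
open import Data.Empty using (⊥-elim)
open import Data.Fin as Fin using (Fin; zero; suc; toℕ; punchIn; punchOut)
import Data.Fin.Properties as Fin
open import Data.Nat as ℕ using (ℕ; zero; suc; ⌊_/2⌋; ⌈_/2⌉; z≤n; s≤s)
import Data.Nat.Properties as ℕ
open import Data.Product using (∃; ∃₂; _×_; _,_; proj₁; proj₂)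
open import Data.Rational as ℚ using (0ℚ; 1ℚ; ∣_∣)
import Data.Rational.Properties as ℚ
open import Data.Rational.Solver using (module +-*-Solver)
open import Data.Sum using (_⊎_; inj₁; inj₂)
open import Data.Vec.Functional using (removeAt; _∷_)
open import Defs
open import Relation.Binary.PropositionalEquality
  using (_≡_; _≢_; refl; sym; trans; cong; subst; subst₂)
open import Relation.Nullary using (yes; no)

-- Adjacent indices

-- Adjacent a b says that b is the successor of a.
data Adjacent : ∀ {n} → Fin n → Fin n → Set where
  here  : ∀ {n} → Adjacent {suc (suc n)} zero (suc zero)
  there : ∀ {n} {a b : Fin n} → Adjacent a b → Adjacent (suc a) (suc b)

adjacent-toℕ : ∀ {n} {a b : Fin n} → Adjacent a b → toℕ b ≡ suc (toℕ a)
adjacent-toℕ here      = refl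
adjacent-toℕ (there p) = cong suc (adjacent-toℕ p)

adjacent-punchOut : ∀ {n} {a b k : Fin (suc n)} → Adjacent a b →
  (k≢a : k ≢ a) (k≢b : k ≢ b) → Adjacent (punchOut k≢a) (punchOut k≢b)
adjacent-punchOut {k = zero}        here k≢a k≢b = ⊥-elim (k≢a refl)
adjacent-punchOut {k = suc zero}    here k≢a k≢b = ⊥-elim (k≢b refl)
adjacent-punchOut {n = suc (suc _)} {k = suc (suc _)} here k≢a k≢b = here
adjacent-punchOut {k = zero}        (there p) k≢a k≢b = p
adjacent-punchOut {n = suc _} {k = suc _} (there p) k≢a k≢b =
  there (adjacent-punchOut p
    (λ eq → k≢a (cong suc eq)) (λ eq → k≢b (cong suc eq)))

-- Omitting a and omitting b give the same list of indices, except that b in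
-- the first stands where a does in the second.
adjacent-punchIn : ∀ {n} {a b : Fin (suc n)} → Adjacent a b → ∀ l →
  punchIn a l ≡ punchIn b l ⊎ (punchIn a l ≡ b × punchIn b l ≡ a)
adjacent-punchIn here      zero    = inj₂ (refl , refl)
adjacent-punchIn here      (suc l) = inj₁ refl
adjacent-punchIn (there p) zero    = inj₁ refl
adjacent-punchIn (there p) (suc l) with adjacent-punchIn p l
... | inj₁ eq          = inj₁ (cong suc eq)
... | inj₂ (eq₁ , eq₂) = inj₂ (cong suc eq₁ , cong suc eq₂)

increasing⊎repeated : ∀ {m} (idx : Fin m → ℕ) →
  (∀ {i j} → i Fin.< j → idx i ℕ.≤ idx j) →
  StrictlyIncreasing idx ⊎ ∃₂ λ a b → Adjacent a b × idx a ≡ idx b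
increasing⊎repeated {zero}        idx mono = inj₁ λ { {()} }
increasing⊎repeated {suc zero}    idx mono = inj₁ λ { {zero} {zero} () }
increasing⊎repeated {suc (suc m)} idx mono
  with idx zero ℕ.≟ idx (suc zero)
     | increasing⊎repeated (λ i → idx (suc i)) (λ i<j → mono (s≤s i<j))
... | yes eq | _                      = inj₂ (_ , _ , here , eq)
... | no _   | inj₂ (a , b , p , eq)  = inj₂ (_ , _ , there p , eq)
... | no neq | inj₁ inc               = inj₁ increasing
  where
  0<1ᵢ : idx zero ℕ.< idx (suc zero)
  0<1ᵢ = ℕ.≤∧≢⇒< (mono (s≤s z≤n)) neq
  increasing : StrictlyIncreasing idx
  increasing {zero}  {suc zero}    _         = 0<1ᵢ
  increasing {zero}  {suc (suc j)} _         = ℕ.<-trans 0<1ᵢ (inc (s≤s z≤n))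
  increasing {suc i} {suc j}       (s≤s i<j) = inc i<j

-- Determinants over a commutative ring

module DeterminantProperties {c ℓ} (R : CommutativeRing c ℓ) where
  open CommutativeRing R
    hiding (zero)
    renaming (refl to ≈-refl; sym to ≈-sym; trans to ≈-trans)
  open Exp semiring using (_^_)
  open Sum semiring
  open Determinant R using () renaming (det to Det)
  open RingProperties ring using (-1*x≈-x)
  open Solver commutativeSemiring using (solve; _:+_; _:*_; _:=_)
  open import Relation.Binary.Reasoning.Setoid setoid

  private
    Matrix : ℕ → Set c
    Matrix n = Fin n → Fin n → Carrier

    -- The cofactor matrix of the entry in row zero and column k.
    omit : ∀ {n} → Matrix (suc n) → Fin (suc n) → Matrix n
    omit M k i = removeAt (M (suc i)) k

    laplaceTerm : ∀ {n} → Matrix (suc n) → Fin (suc n) → Carrier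
    laplaceTerm M k = (- 1#) ^ toℕ k * (M zero k * Det (omit M k))

  sum-zero : ∀ {n} (f : Fin n → Carrier) → (∀ k → f k ≈ 0#) → sum f ≈ 0#
  sum-zero {n} f f≈0 = ≈-trans (sum-cong-≋ f≈0) (sum-replicate-zero n)

  sum-linear : ∀ {n} x y (f g h : Fin n → Carrier) →
    (∀ k → f k ≈ x * g k + y * h k) → sum f ≈ x * sum g + y * sum h
  sum-linear x y f g h f≈ = begin
    sum f                                        ≈⟨ sum-cong-≋ f≈ ⟩
    sum (λ k → x * g k + y * h k)                ≈⟨ ∑-distrib-+ (λ k → x * g k) (λ k → y * h k) ⟩
    sum (λ k → x * g k) + sum (λ k → y * h k)    ≈⟨ +-cong (*-distribˡ-sum x g) (*-distribˡ-sum y h) ⟨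
    x * sum g + y * sum h                        ∎

  sum-cancel : ∀ {n} {a b : Fin n} → Adjacent a b → (f : Fin n → Carrier) →
    f a + f b ≈ 0# → (∀ k → k ≢ a → k ≢ b → f k ≈ 0#) → sum f ≈ 0#
  sum-cancel (here {n}) f fa+fb≈0 f≈0 = begin
    f zero + (f (suc zero) + sum rest)    ≈⟨ +-assoc (f zero) (f (suc zero)) (sum rest) ⟨
    (f zero + f (suc zero)) + sum rest    ≈⟨ +-cong fa+fb≈0 (sum-zero rest λ k → f≈0 (suc (suc k)) (λ ()) (λ ())) ⟩
    0# + 0#                            ≈⟨ +-identityʳ 0# ⟩
    0#                                 ∎
    where
    rest : Fin n → Carrier
    rest k = f (suc (suc k))
  sum-cancel (there p) f fa+fb≈0 f≈0 = begin
    f zero + sum (λ k → f (suc k))     ≈⟨ +-cong (f≈0 zero (λ ()) (λ ()))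
                                            (sum-cancel p (λ k → f (suc k)) fa+fb≈0
                                              λ k k≢a k≢b → f≈0 (suc k)
                                                (λ eq → k≢a (Fin.suc-injective eq))
                                                (λ eq → k≢b (Fin.suc-injective eq))) ⟩
    0# + 0#                            ≈⟨ +-identityʳ 0# ⟩
    0#                                 ∎

  det-cong : ∀ {n} {M N : Matrix n} → (∀ i j → M i j ≈ N i j) → Det M ≈ Det N
  det-cong {zero}  M≈N = ≈-refl
  det-cong {suc n} M≈N = sum-cong-≋ λ k →
    *-congˡ {x = (- 1#) ^ toℕ k} (*-cong (M≈N zero k) (det-cong λ i j → M≈N (suc i) (punchIn k j)))

  det-linear : ∀ {n} (j : Fin n) (x y : Carrier) {M P Q : Matrix n} →
    (∀ i → M i j ≈ x * P i j + y * Q i j) →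
    (∀ i k → k ≢ j → M i k ≈ P i k × M i k ≈ Q i k) →
    Det M ≈ x * Det P + y * Det Q
  det-linear {suc n} j x y {M} {P} {Q} at off =
    sum-linear x y (laplaceTerm M) (laplaceTerm P) (laplaceTerm Q) term
    where
    term : ∀ k → laplaceTerm M k ≈ x * laplaceTerm P k + y * laplaceTerm Q k
    term k with k Fin.≟ j
    ... | yes refl = begin
      e * (M zero k * Det (omit M k))
        ≈⟨ *-congˡ (*-congʳ (at zero)) ⟩
      e * ((x * P zero k + y * Q zero k) * Det (omit M k))
        ≈⟨ solve 6 (λ e x p y q m → e :* ((x :* p :+ y :* q) :* m) :=
             x :* (e :* (p :* m)) :+ y :* (e :* (q :* m)))
             ≈-refl e x (P zero k) y (Q zero k) (Det (omit M k)) ⟩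
      x * (e * (P zero k * Det (omit M k))) + y * (e * (Q zero k * Det (omit M k)))
        ≈⟨ +-cong
             (*-congˡ (*-congˡ (*-congˡ (det-cong λ i l →
               proj₁ (off (suc i) (punchIn k l) (Fin.punchInᵢ≢i k l))))))
             (*-congˡ (*-congˡ (*-congˡ (det-cong λ i l →
               proj₂ (off (suc i) (punchIn k l) (Fin.punchInᵢ≢i k l)))))) ⟩
      x * laplaceTerm P k + y * laplaceTerm Q k
        ∎
      where e = (- 1#) ^ toℕ k
    ... | no k≢j = begin
      e * (M zero k * Det (omit M k))
        ≈⟨ *-congˡ (*-congˡ (det-linear (punchOut k≢j) x y at′ off′)) ⟩
      e * (M zero k * (x * Det (omit P k) + y * Det (omit Q k)))
        ≈⟨ solve 6 (λ e m x p y q → e :* (m :* (x :* p :+ y :* q)) :=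
             x :* (e :* (m :* p)) :+ y :* (e :* (m :* q)))
             ≈-refl e (M zero k) x (Det (omit P k)) y (Det (omit Q k)) ⟩
      x * (e * (M zero k * Det (omit P k))) + y * (e * (M zero k * Det (omit Q k)))
        ≈⟨ +-cong (*-congˡ (*-congˡ (*-congʳ (proj₁ (off zero k k≢j)))))
                  (*-congˡ (*-congˡ (*-congʳ (proj₂ (off zero k k≢j))))) ⟩
      x * laplaceTerm P k + y * laplaceTerm Q k
        ∎
      where
      e = (- 1#) ^ toℕ k
      at′ : ∀ i → omit M k i (punchOut k≢j) ≈
            x * omit P k i (punchOut k≢j) + y * omit Q k i (punchOut k≢j)
      at′ i = subst (λ l → M (suc i) l ≈ x * P (suc i) l + y * Q (suc i) l)
        (sym (Fin.punchIn-punchOut k≢j)) (at (suc i))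
      off′ : ∀ i l → l ≢ punchOut k≢j →
             omit M k i l ≈ omit P k i l × omit M k i l ≈ omit Q k i l
      off′ i l l≢ = off (suc i) (punchIn k l) λ eq → l≢ (Fin.punchIn-injective k l _
        (trans eq (sym (Fin.punchIn-punchOut k≢j))))

  -- In the expansion along row zero, the terms of the two equal columns
  -- cancel, and in every other term the cofactor has equal adjacent columns.
  det-repeated : ∀ {n} {a b : Fin n} → Adjacent a b → (M : Matrix n) →
    (∀ i → M i a ≈ M i b) → Det M ≈ 0#
  det-repeated {suc n} {a} {b} adj M Ma≈Mb =
    sum-cancel adj (laplaceTerm M) cancel vanish
    where
    same : ∀ i l → omit M b i l ≈ omit M a i l
    same i l with adjacent-punchIn adj l
    ... | inj₁ eq          = reflexive (cong (M (suc i)) (sym eq))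
    ... | inj₂ (eq₁ , eq₂) = begin
      M (suc i) (punchIn b l)    ≡⟨ cong (M (suc i)) eq₂ ⟩
      M (suc i) a                ≈⟨ Ma≈Mb (suc i) ⟩
      M (suc i) b                ≡⟨ cong (M (suc i)) eq₁ ⟨
      M (suc i) (punchIn a l)    ∎
    u v : Carrier
    u = (- 1#) ^ toℕ a
    v = M zero a * Det (omit M a)
    cancel : laplaceTerm M a + laplaceTerm M b ≈ 0#
    cancel = begin
      u * v + (- 1#) ^ toℕ b * (M zero b * Det (omit M b))
        ≈⟨ +-congˡ (*-cong (reflexive (cong ((- 1#) ^_) (adjacent-toℕ adj)))
             (*-cong (≈-sym (Ma≈Mb zero)) (det-cong same))) ⟩
      u * v + (- 1# * u) * v
        ≈⟨ +-congˡ (*-assoc _ _ _) ⟩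
      u * v + - 1# * (u * v)
        ≈⟨ +-congˡ (-1*x≈-x (u * v)) ⟩
      u * v + - (u * v)
        ≈⟨ -‿inverseʳ (u * v) ⟩
      0# ∎
    vanish : ∀ k → k ≢ a → k ≢ b → laplaceTerm M k ≈ 0#
    vanish k k≢a k≢b = begin
      (- 1#) ^ toℕ k * (M zero k * Det (omit M k))
        ≈⟨ *-congˡ (*-congˡ (det-repeated (adjacent-punchOut adj k≢a k≢b) (omit M k) λ i →
             subst₂ (λ p q → M (suc i) p ≈ M (suc i) q)
               (sym (Fin.punchIn-punchOut k≢a)) (sym (Fin.punchIn-punchOut k≢b))
               (Ma≈Mb (suc i)))) ⟩
      (- 1#) ^ toℕ k * (M zero k * 0#)
        ≈⟨ *-congˡ (zeroʳ _) ⟩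
      (- 1#) ^ toℕ k * 0#
        ≈⟨ zeroʳ _ ⟩
      0# ∎

  det-firstRow : ∀ {n} (M : Matrix (suc n)) → (∀ j → M zero (suc j) ≈ 0#) →
    Det M ≈ M zero zero * Det (λ i j → M (suc i) (suc j))
  det-firstRow M M₀≈0 = begin
    1# * (M zero zero * Det (omit M zero)) + sum (λ k → laplaceTerm M (suc k))
      ≈⟨ +-cong (*-identityˡ _) (sum-zero _ λ k →
           ≈-trans (*-congˡ (≈-trans (*-congʳ (M₀≈0 k)) (zeroˡ _))) (zeroʳ _)) ⟩
    M zero zero * Det (omit M zero) + 0#
      ≈⟨ +-identityʳ _ ⟩
    M zero zero * Det (omit M zero) ∎

open DeterminantProperties ℝ-commutativeRing

-- Nonnegative real numbers

p≤∣p∣ : ∀ p → p ℚ.≤ ∣ p ∣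
p≤∣p∣ p with ℚ.≤-total 0ℚ p
... | inj₁ 0≤p = ℚ.≤-reflexive (sym (ℚ.0≤p⇒∣p∣≡p 0≤p))
... | inj₂ p≤0 = ℚ.≤-trans p≤0 (ℚ.0≤∣p∣ p)

nonNeg-resp-≃ : ∀ {x y} → x ≃ y → 0ℝ ≤ x → 0ℝ ≤ y
nonNeg-resp-≃ {x} {y} x≃y 0≤x .below ε 0<ε with halve ε 0<ε
... | δ , 0<δ , refl = both
  (λ n 0≤xₙ+δ ∣xₙ-yₙ∣<δ → begin
    0ℚ                                      ≤⟨ 0≤xₙ+δ ⟩
    seq x n ℚ.+ δ                           ≡⟨ solve 3 (λ x y δ → x :+ δ := y :+ ((x :- y) :+ δ))
                                                 refl (seq x n) (seq y n) δ ⟩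
    seq y n ℚ.+ ((seq x n ℚ.- seq y n) ℚ.+ δ)
      ≤⟨ ℚ.+-monoʳ-≤ (seq y n) (ℚ.+-monoˡ-≤ δ
           (ℚ.≤-trans (p≤∣p∣ (seq x n ℚ.- seq y n)) (ℚ.<⇒≤ ∣xₙ-yₙ∣<δ))) ⟩
    seq y n ℚ.+ (δ ℚ.+ δ)                   ∎)
  (below 0≤x δ 0<δ) (close x≃y δ 0<δ)
  where
  open ℚ.≤-Reasoning
  open +-*-Solver

nonNeg-⊕ : ∀ {x y} → 0ℝ ≤ x → 0ℝ ≤ y → 0ℝ ≤ x ⊕ y
nonNeg-⊕ {x} {y} 0≤x 0≤y .below ε 0<ε with halve ε 0<ε
... | δ , 0<δ , refl = both
  (λ n 0≤xₙ+δ 0≤yₙ+δ → subst (0ℚ ℚ.≤_)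
    (solve 3 (λ x y δ → (x :+ δ) :+ (y :+ δ) := (x :+ y) :+ (δ :+ δ))
      refl (seq x n) (seq y n) δ)
    (ℚ.+-mono-≤ 0≤xₙ+δ 0≤yₙ+δ))
  (below 0≤x δ 0<δ) (below 0≤y δ 0<δ)
  where open +-*-Solver

nonNeg-⊖ : ∀ {x y} → x ≤ y → 0ℝ ≤ y ⊕ ⊖ x
nonNeg-⊖ {x} {y} x≤y .below ε 0<ε with below x≤y ε 0<ε
... | N , h = N , λ n N≤n → subst₂ ℚ._≤_
  (ℚ.+-inverseʳ (seq x n))
  (solve 3 (λ x y ε → (y :+ ε) :- x := (y :- x) :+ ε) refl (seq x n) (seq y n) ε)
  (ℚ.+-monoˡ-≤ (ℚ.- seq x n) (h n N≤n))
  where open +-*-Solver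

*-nonNeg-ℚ : ∀ {p q} → 0ℚ ℚ.≤ p → 0ℚ ℚ.≤ q → 0ℚ ℚ.≤ p ℚ.* q
*-nonNeg-ℚ {p} {q} 0≤p 0≤q = subst (ℚ._≤ p ℚ.* q) (ℚ.*-zeroˡ q)
  (ℚ.*-monoʳ-≤-nonNeg q ⦃ ℚ.nonNegative 0≤q ⦄ 0≤p)

-- The right-hand side is (p + δ) * q + (B - q) * δ + B * δ, a sum of
-- nonnegative terms.
*-almostNonNegʳ : ∀ B δ p q → 0ℚ ℚ.< B → 0ℚ ℚ.< δ →
  0ℚ ℚ.≤ p ℚ.+ δ → 0ℚ ℚ.≤ q → q ℚ.< B → 0ℚ ℚ.≤ p ℚ.* q ℚ.+ (B ℚ.* δ ℚ.+ B ℚ.* δ)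
*-almostNonNegʳ B δ p q 0<B 0<δ 0≤p+δ 0≤q q<B = subst (0ℚ ℚ.≤_)
  (solve 4 (λ B δ p q → ((p :+ δ) :* q :+ (B :- q) :* δ) :+ B :* δ :=
                        p :* q :+ (B :* δ :+ B :* δ)) refl B δ p q)
  (ℚ.+-mono-≤
    (ℚ.+-mono-≤ (*-nonNeg-ℚ 0≤p+δ 0≤q) (*-nonNeg-ℚ 0≤B-q (ℚ.<⇒≤ 0<δ)))
    (*-nonNeg-ℚ (ℚ.<⇒≤ 0<B) (ℚ.<⇒≤ 0<δ)))
  where
  open +-*-Solver
  0≤B-q : 0ℚ ℚ.≤ B ℚ.- q
  0≤B-q = subst (ℚ._≤ B ℚ.- q) (ℚ.+-inverseʳ q) (ℚ.+-monoˡ-≤ (ℚ.- q) (ℚ.<⇒≤ q<B))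

*-almostNonNeg : ∀ B δ p q → 0ℚ ℚ.< B → 0ℚ ℚ.< δ → ∣ p ∣ ℚ.< B → ∣ q ∣ ℚ.< B →
  0ℚ ℚ.≤ p ℚ.+ δ → 0ℚ ℚ.≤ q ℚ.+ δ → 0ℚ ℚ.≤ p ℚ.* q ℚ.+ (B ℚ.* δ ℚ.+ B ℚ.* δ)
*-almostNonNeg B δ p q 0<B 0<δ p<B q<B 0≤p+δ 0≤q+δ
  with ℚ.≤-total 0ℚ q | ℚ.≤-total 0ℚ p
... | inj₁ 0≤q | _        =
  *-almostNonNegʳ B δ p q 0<B 0<δ 0≤p+δ 0≤q (ℚ.≤-<-trans (p≤∣p∣ q) q<B)
... | inj₂ _   | inj₁ 0≤p = subst (λ x → 0ℚ ℚ.≤ x ℚ.+ (B ℚ.* δ ℚ.+ B ℚ.* δ))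
  (ℚ.*-comm q p)
  (*-almostNonNegʳ B δ q p 0<B 0<δ 0≤q+δ 0≤p (ℚ.≤-<-trans (p≤∣p∣ p) p<B))
... | inj₂ q≤0 | inj₂ p≤0 = ℚ.+-mono-≤
  (subst (0ℚ ℚ.≤_) (solve 2 (λ p q → (:- p) :* (:- q) := p :* q) refl p q)
    (*-nonNeg-ℚ (ℚ.neg-antimono-≤ p≤0) (ℚ.neg-antimono-≤ q≤0)))
  (ℚ.+-mono-≤ 0≤Bδ 0≤Bδ)
  where
  open +-*-Solver
  0≤Bδ : 0ℚ ℚ.≤ B ℚ.* δ
  0≤Bδ = *-nonNeg-ℚ (ℚ.<⇒≤ 0<B) (ℚ.<⇒≤ 0<δ)

nonNeg-⊗ : ∀ {x y} → 0ℝ ≤ x → 0ℝ ≤ y → 0ℝ ≤ x ⊗ y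
nonNeg-⊗ {x} {y} 0≤x 0≤y .below ε 0<ε with bounded₂ x y
... | B , 0<B , bounds with halve/ B ε 0<B 0<ε
... | δ , 0<δ , refl = both
  (λ n (∣xₙ∣<B , ∣yₙ∣<B) (0≤xₙ+δ , 0≤yₙ+δ) →
    *-almostNonNeg B δ (seq x n) (seq y n) 0<B 0<δ ∣xₙ∣<B ∣yₙ∣<B 0≤xₙ+δ 0≤yₙ+δ)
  bounds (both (λ _ → _,_) (below 0≤x δ 0<δ) (below 0≤y δ 0<δ))

nonNeg-0 : 0ℝ ≤ 0ℝ
nonNeg-0 .below ε 0<ε = 0 , λ _ _ → ℚ.+-mono-≤ (ℚ.≤-refl {0ℚ}) (ℚ.<⇒≤ 0<ε)

nonNeg-1 : 0ℝ ≤ 1ℝ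
nonNeg-1 .below ε 0<ε = 0 , λ _ _ → ℚ.+-mono-≤ (ℚ.<⇒≤ 0<1) (ℚ.<⇒≤ 0<ε)

-- Multilinear functions on products of cones

module _ {C : Set} where

  -- A column is a family of reals with index set C, up to pointwise equality.
  Column : Set
  Column = C → ℝ

  -- Linearity in argument j compares three families of columns that agree
  -- away from j, up to pointwise equality.
  record Multilinear {m} (F : (Fin m → Column) → ℝ) : Set where
    field
      respects : ∀ {c d} → (∀ j i → c j i ≃ d j i) → F c ≃ F d
      linear   : ∀ j x y {c d e} →
        (∀ i → c j i ≃ x ⊗ d j i ⊕ y ⊗ e j i) →
        (∀ k → k ≢ j → (∀ i → c k i ≃ d k i) × (∀ i → c k i ≃ e k i)) →
        F c ≃ x ⊗ F d ⊕ y ⊗ F e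

  open Multilinear

  -- Cone V S c says that c is a combination with nonnegative coefficients of
  -- columns V k such that S k.
  data Cone (V : ℕ → Column) (S : ℕ → Set) (c : Column) : Set where
    generator : ∀ k → S k → (∀ i → c i ≃ V k i) → Cone V S c
    combine   : ∀ {x y d e} → 0ℝ ≤ x → 0ℝ ≤ y → Cone V S d → Cone V S e →
                (∀ i → c i ≃ x ⊗ d i ⊕ y ⊗ e i) → Cone V S c

  Multilinear-tail : ∀ {m} {F : (Fin (suc m) → Column) → ℝ} → Multilinear F →
    ∀ c → Multilinear (λ d → F (c ∷ d))
  Multilinear-tail {F = F} lin c .respects c≃d = lin .respects λ where
    zero    i → ≃-refl
    (suc j) i → c≃d j i
  Multilinear-tail {F = F} lin c .linear j x y at off =
    lin .linear (suc j) x y at λ where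
      zero    _   → (λ _ → ≃-refl) , (λ _ → ≃-refl)
      (suc k) k≢j → off k λ eq → k≢j (cong suc eq)

  cong-∷ : ∀ {m} {F : (Fin (suc m) → Column) → ℝ} → Multilinear F →
    ∀ c → F (c zero ∷ λ j → c (suc j)) ≃ F c
  cong-∷ lin c = lin .respects λ where
    zero    i → ≃-refl
    (suc j) i → ≃-refl

  -- Nonnegativity at all choices of generators extends to the product of the
  -- cones, by resolving the arguments into generators one after the other.
  multilinear-nonNeg : ∀ {m} {F : (Fin m → Column) → ℝ} → Multilinear F →
    ∀ {V : ℕ → Column} {S : Fin m → ℕ → Set} →
    (∀ (idx : Fin m → ℕ) → (∀ j → S j (idx j)) → 0ℝ ≤ F (λ j → V (idx j))) →
    ∀ c → (∀ j → Cone V (S j) (c j)) → 0ℝ ≤ F c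
  multilinear-nonNeg {zero} lin onGenerators c cones =
    nonNeg-resp-≃ (lin .respects λ ()) (onGenerators (λ ()) λ ())
  multilinear-nonNeg {suc m} {F} lin {V} {S} onGenerators c cones =
    nonNeg-resp-≃ (cong-∷ lin c) (first (cones zero))
    where
    tail : Fin m → Column
    tail j = c (suc j)
    first : ∀ {d} → Cone V (S zero) d → 0ℝ ≤ F (d ∷ tail)
    first (generator k Sk d≃V) = nonNeg-resp-≃
      (lin .respects λ where
        zero    i → ≃-sym (d≃V i)
        (suc j) i → ≃-refl)
      (multilinear-nonNeg (Multilinear-tail lin (V k))
        (λ idx Sidx → nonNeg-resp-≃
          (≃-sym (cong-∷ lin (λ j → V ((k ∷ idx) j))))
          (onGenerators (k ∷ idx) λ where
            zero    → Sk
            (suc j) → Sidx j))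
        tail (λ j → cones (suc j)))
    first (combine {x} {y} 0≤x 0≤y p q d≃) = nonNeg-resp-≃
      (≃-sym (lin .linear zero x y d≃ λ where
        zero    0≢0 → ⊥-elim (0≢0 refl)
        (suc k) _   → (λ _ → ≃-refl) , (λ _ → ≃-refl)))
      (nonNeg-⊕ (nonNeg-⊗ 0≤x (first p)) (nonNeg-⊗ 0≤y (first q)))

det-multilinear : ∀ {m} → Multilinear {C = Fin m} (λ c → det λ i j → c j i)
det-multilinear = record
  { respects = λ c≃d → det-cong λ i j → c≃d j i
  ; linear   = λ j x y at off → det-linear j x y at λ i k k≢j →
      proj₁ (off k k≢j) i , proj₂ (off k k≢j) i
  }

-- Windows of columns

-- The maximal minors of a matrix with m rows and infinitely many columns,
-- given as the sequence of its columns, are nonnegative.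
ColumnPositive : ∀ {m} → (ℕ → Fin m → ℝ) → Set
ColumnPositive V = ∀ cols → StrictlyIncreasing cols → 0ℝ ≤ det λ i j → V (cols j) i

-- The windowing principle: the hypothesis on lo and hi makes every choice of
-- generators weakly increasing.
colPositive-windows : ∀ {m} {V W : ℕ → Fin m → ℝ} (lo hi : ℕ → ℕ) →
  (∀ {k k′} → k ℕ.< k′ → hi k ℕ.≤ lo k′) →
  (∀ k → Cone V (λ n → lo k ℕ.≤ n × n ℕ.≤ hi k) (W k)) →
  ColumnPositive V → ColumnPositive W
colPositive-windows {V = V} {W} lo hi hi≤lo cones V-pos cols inc =
  multilinear-nonNeg det-multilinear
    onGenerators (λ j → W (cols j)) (λ j → cones (cols j))
  where
  onGenerators : ∀ idx → (∀ j → lo (cols j) ℕ.≤ idx j × idx j ℕ.≤ hi (cols j)) →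
                 0ℝ ≤ det λ i j → V (idx j) i
  onGenerators idx within
    with increasing⊎repeated idx (λ i<j → ℕ.≤-trans (proj₂ (within _))
           (ℕ.≤-trans (hi≤lo (inc i<j)) (proj₁ (within _))))
  ... | inj₁ idx-inc            = V-pos idx idx-inc
  ... | inj₂ (a , b , adj , eq) = nonNeg-resp-≃
    (≃-sym (det-repeated adj _ λ i → CommutativeRing.reflexive ℝ-commutativeRing
      (cong (λ n → V n i) eq)))
    nonNeg-0

⌊k*2/2⌋≡k : ∀ k → ⌊ k ℕ.* 2 /2⌋ ≡ k
⌊k*2/2⌋≡k zero    = refl
⌊k*2/2⌋≡k (suc k) = cong suc (⌊k*2/2⌋≡k k)

⌈k*2/2⌉≡k : ∀ k → ⌈ k ℕ.* 2 /2⌉ ≡ k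
⌈k*2/2⌉≡k zero    = refl
⌈k*2/2⌉≡k (suc k) = cong suc (⌈k*2/2⌉≡k k)

-- spread t takes the value t (k + 1) at 2 k + 1 and vanishes at even indices.
spread : (ℕ → ℝ) → ℕ → ℝ
spread t zero          = 0ℝ
spread t (suc zero)    = t 1
spread t (suc (suc n)) = spread (λ k → t (suc k)) n

spread-even : ∀ t k → spread t (k ℕ.* 2) ≡ 0ℝ
spread-even t zero    = refl
spread-even t (suc k) = spread-even (λ k → t (suc k)) k

spread-odd : ∀ t k → spread t (suc (k ℕ.* 2)) ≡ t (suc k)
spread-odd t zero    = refl
spread-odd t (suc k) = spread-odd (λ k → t (suc k)) k

spread-nonNeg : ∀ t → (∀ k → 0ℝ ≤ t (suc k)) → ∀ n → 0ℝ ≤ spread t n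
spread-nonNeg t 0≤t zero          = nonNeg-0
spread-nonNeg t 0≤t (suc zero)    = 0≤t 0
spread-nonNeg t 0≤t (suc (suc n)) = spread-nonNeg (λ k → t (suc k)) (λ k → 0≤t (suc k)) n

-- The columns V k and V k + t (k + 1) * V (k + 1), interleaved: these are the
-- columns with index 2 k and 2 k + 1.
interleave : ∀ {m} → (ℕ → ℝ) → (ℕ → Fin m → ℝ) → ℕ → Fin m → ℝ
interleave t V n i = V ⌊ n /2⌋ i ⊕ spread t n ⊗ V ⌈ n /2⌉ i

interleave-even : ∀ {m} t (V : ℕ → Fin m → ℝ) k i →
  V k i ≃ interleave t V (k ℕ.* 2) i
interleave-even t V k i
  rewrite ⌊k*2/2⌋≡k k | ⌈k*2/2⌉≡k k | spread-even t k = pointwise λ n →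
    solve 1 (λ a → a := a :+ con 0ℚ :* a) refl (seq (V k i) n)
  where open +-*-Solver

interleave-odd : ∀ {m} t (V : ℕ → Fin m → ℝ) k i →
  V k i ⊕ t (suc k) ⊗ V (suc k) i ≃ interleave t V (suc (k ℕ.* 2)) i
interleave-odd t V k i
  rewrite ⌈k*2/2⌉≡k k | ⌊k*2/2⌋≡k k | spread-odd t k = ≃-refl

-- Column n lies in the window from ⌊ n /2⌋ to ⌈ n /2⌉, and the windows are in
-- order since ⌈ n /2⌉ = ⌊ suc n /2⌋.
interleave-positive : ∀ {m} t (V : ℕ → Fin m → ℝ) → (∀ k → 0ℝ ≤ t (suc k)) →
  ColumnPositive V → ColumnPositive (interleave t V)
interleave-positive t V 0≤t = colPositive-windows {V = V} ⌊_/2⌋ ⌈_/2⌉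
  (λ k<k′ → ℕ.⌊n/2⌋-mono k<k′)
  (λ n → combine nonNeg-1 (spread-nonNeg t 0≤t n)
    (generator ⌊ n /2⌋ (ℕ.≤-refl , ℕ.⌊n/2⌋≤⌈n/2⌉ n) λ _ → ≃-refl)
    (generator ⌈ n /2⌉ (ℕ.⌊n/2⌋≤⌈n/2⌉ n , ℕ.≤-refl) λ _ → ≃-refl)
    λ i → ⊕-cong (≃-sym (CommutativeRing.*-identityˡ ℝ-commutativeRing _)) ≃-refl)

-- The recursive matrix

module _ (r s t : ℕ → ℝ)
  (0≤r  : ∀ k → 1 ℕ.≤ k → 0ℝ ≤ r k)
  (0≤t  : ∀ k → 1 ℕ.≤ k → 0ℝ ≤ t k)
  (1≤s₀ : 1ℝ ≤ s 0)
  (rt≤s : ∀ k → 1 ℕ.≤ k → r k ⊗ t k ⊕ 1ℝ ≤ s k)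
  where

  private
    A : InfiniteMatrix
    A = recursiveMatrix r s t

    -- The selected rows of A, as a sequence of columns.
    rowsOf : ∀ {m} → (Fin m → ℕ) → ℕ → Fin m → ℝ
    rowsOf rows k i = A (rows i) k

  0≤t′ : ∀ k → 0ℝ ≤ t (suc k)
  0≤t′ k = 0≤t (suc k) (s≤s z≤n)

  -- Column k of the shifted rows is a combination of the interleaved columns
  -- 2 k - 1, 2 k and 2 k + 1, with coefficients r k, d k and 1; the
  -- truncated subtraction discards the first of them when k = 0.
  shift-cone : ∀ {m} (rows : Fin m → ℕ) k →
    Cone (interleave t (rowsOf rows))
      (λ n → k ℕ.* 2 ℕ.∸ 1 ℕ.≤ n × n ℕ.≤ suc (k ℕ.* 2))
      (rowsOf (λ i → suc (rows i)) k)
  shift-cone rows zero = combine (nonNeg-⊖ 1≤s₀) nonNeg-1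
    (generator 0 (z≤n , z≤n) λ i → interleave-even t (rowsOf rows) 0 i)
    (generator 1 (z≤n , s≤s z≤n) λ i → interleave-odd t (rowsOf rows) 0 i)
    λ i → pointwise λ n →
      solve 4 (λ s t a b → s :* a :+ t :* b :=
                 (s :- con 1ℚ) :* a :+ con 1ℚ :* (a :+ t :* b))
        refl (seq (s 0) n) (seq (t 1) n) (seq (A (rows i) 0) n) (seq (A (rows i) 1) n)
    where open +-*-Solver
  shift-cone rows (suc k) = combine (0≤r (suc k) (s≤s z≤n)) nonNeg-1
    (generator (suc (k ℕ.* 2)) (ℕ.≤-refl , ℕ.m≤n⇒m≤1+n (ℕ.n≤1+n _))
      λ i → interleave-odd t (rowsOf rows) k i)
    (combine (nonNeg-⊖ (rt≤s (suc k) (s≤s z≤n))) nonNeg-1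
      (generator (suc k ℕ.* 2) (ℕ.n≤1+n _ , ℕ.n≤1+n _)
        λ i → interleave-even t (rowsOf rows) (suc k) i)
      (generator (suc (suc k ℕ.* 2)) (ℕ.m≤n⇒m≤1+n (ℕ.n≤1+n _) , ℕ.≤-refl)
        λ i → interleave-odd t (rowsOf rows) (suc k) i)
      λ _ → ≃-refl)
    λ i → pointwise λ n →
      solve 7 (λ r s t t′ a b c →
          (r :* a :+ s :* b) :+ t′ :* c :=
          r :* (a :+ t :* b) :+
          con 1ℚ :* ((s :- (r :* t :+ con 1ℚ)) :* b :+ con 1ℚ :* (b :+ t′ :* c)))
        refl (seq (r (suc k)) n) (seq (s (suc k)) n)
        (seq (t (suc k)) n) (seq (t (suc (suc k))) n)
        (seq (A (rows i) k) n) (seq (A (rows i) (suc k)) n)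
        (seq (A (rows i) (suc (suc k))) n)
    where open +-*-Solver

  shift-positive : ∀ {m} (rows : Fin m → ℕ) →
    ColumnPositive (rowsOf rows) → ColumnPositive (rowsOf (λ i → suc (rows i)))
  shift-positive rows positive = colPositive-windows
    {V = interleave t (rowsOf rows)}
    (λ k → k ℕ.* 2 ℕ.∸ 1) (λ k → suc (k ℕ.* 2))
    (λ { {k′ = suc _} (s≤s k≤k′) → s≤s (ℕ.*-monoˡ-≤ 2 k≤k′) })
    (shift-cone rows)
    (interleave-positive t (rowsOf rows) 0≤t′ positive)

  -- The minors on rows below N are nonnegative.
  PositiveBelow : ℕ → Set
  PositiveBelow N = ∀ {m} (rows : Fin m → ℕ) → StrictlyIncreasing rows →
    (∀ i → rows i ℕ.< N) → ColumnPositive (rowsOf rows)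

  -- Nonzero rows of A are rows of A J, so shift-positive applies to their
  -- predecessors.
  minor-suc-nonNeg : ∀ {N} → PositiveBelow N →
    ∀ {m} (rows : Fin m → ℕ) → StrictlyIncreasing rows →
    (∀ i → 0 ℕ.< rows i) → (∀ i → rows i ℕ.< suc N) → ColumnPositive (rowsOf rows)
  minor-suc-nonNeg below-N rows inc 0<rows rows<1+N cols cols-inc = nonNeg-resp-≃
    (det-cong λ i j → CommutativeRing.reflexive ℝ-commutativeRing
      (cong (λ n → A n (cols j)) (suc-pred i)))
    (shift-positive (λ i → ℕ.pred (rows i))
      (below-N _ (λ {i} {j} i<j → ℕ.s<s⁻¹ (subst₂ ℕ._<_
          (sym (suc-pred i)) (sym (suc-pred j)) (inc i<j)))
        (λ i → subst (ℕ._≤ _) (sym (suc-pred i)) (ℕ.s≤s⁻¹ (rows<1+N i))))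
      cols cols-inc)
    where
    suc-pred : ∀ i → suc (ℕ.pred (rows i)) ≡ rows i
    suc-pred i = ℕ.suc-pred (rows i) ⦃ ℕ.>-nonZero (0<rows i) ⦄

  row₀-nonNeg : ∀ k → 0ℝ ≤ A 0 k
  row₀-nonNeg zero    = nonNeg-1
  row₀-nonNeg (suc k) = nonNeg-0

  row₀-vanishes : ∀ {n k} → n ℕ.< k → A 0 k ≃ 0ℝ
  row₀-vanishes (s≤s _) = ≃-refl

  positiveBelow : ∀ N → PositiveBelow N
  positiveBelow N       {zero}  rows inc rows<N cols cols-inc = nonNeg-1
  positiveBelow zero    {suc m} rows inc rows<N with () ← rows<N zero
  positiveBelow (suc N) {suc m} rows inc rows<N cols cols-inc
    with rows zero ℕ.≟ 0
  ... | no r₀≢0 = minor-suc-nonNeg (positiveBelow N) rows inc 0<rows rows<N cols cols-inc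
    where
    0<rows : ∀ i → 0 ℕ.< rows i
    0<rows zero    = ℕ.n≢0⇒n>0 r₀≢0
    0<rows (suc i) = ℕ.≤-<-trans z≤n (inc {zero} {suc i} (s≤s z≤n))
  -- Row zero is selected: it is a unit vector, and the minor factors as its
  -- leading entry times a minor on nonzero rows.
  ... | yes eq = nonNeg-resp-≃
    (≃-sym (det-firstRow (λ i j → A (rows i) (cols j)) λ j →
      subst (λ n → A n (cols (suc j)) ≃ 0ℝ) (sym eq)
        (row₀-vanishes (cols-inc {zero} {suc j} (s≤s z≤n)))))
    (nonNeg-⊗
      (subst (λ n → 0ℝ ≤ A n (cols zero)) (sym eq) (row₀-nonNeg (cols zero)))
      (minor-suc-nonNeg (positiveBelow N) (λ i → rows (suc i))
        (λ i<j → inc (s≤s i<j))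
        (λ i → ℕ.≤-<-trans z≤n (inc {zero} {suc i} (s≤s z≤n)))
        (λ i → rows<N (suc i))
        (λ j → cols (suc j)) (λ i<j → cols-inc (s≤s i<j))))

bounded-rows : ∀ {m} (rows : Fin m → ℕ) → ∃ λ N → ∀ i → rows i ℕ.< N
bounded-rows {zero}  rows = 0 , λ ()
bounded-rows {suc m} rows with bounded-rows (λ i → rows (suc i))
... | N , rows<N = suc (rows zero) ℕ.⊔ N , λ where
  zero    → ℕ.m≤m⊔n (suc (rows zero)) N
  (suc i) → ℕ.≤-trans (rows<N i) (ℕ.m≤n⊔m (suc (rows zero)) N)

theorem2p9 : (r s t : ℕ → ℝ) →
    (∀ k → 1 ℕ.≤ k → 0ℝ ≤ r k) →
    (∀ k → 0ℝ ≤ s k) →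
    (∀ k → 1 ℕ.≤ k → 0ℝ ≤ t k) →
    1ℝ ≤ s 0 →
    (∀ k → 1 ℕ.≤ k → r k ⊗ t k ⊕ 1ℝ ≤ s k) →
    TotallyPositive (recursiveMatrix r s t)
theorem2p9 r s t 0≤r _ 0≤t 1≤s₀ rt≤s rows cols rows-inc cols-inc =
  positiveBelow r s t 0≤r 0≤t 1≤s₀ rt≤s (proj₁ (bounded-rows rows))
    rows rows-inc (proj₂ (bounded-rows rows)) cols cols-inc
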